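{- Let $G$ be a finite simple connected graph. Then $G$ satisfies property (P3) if and only if $G$ is a vertebrate graph.
   Context: For a connected graph $G$, $d(u,v)$ denotes the shortest-path distance in $G$, $N(x)$ the set of neighbours of $x$, and $N[x]=N(x)\cup\{x\}$; for a vertex set/induced subgraph $R$, $N[R]=\bigcup_{r\in V(R)}N[r]$. For $c,x\in V(G)$ with $d(c,x)\ge 2$, let $N(c,x)=\{v\in N(c): d(c,x)=1+d(v,x)\}$, and for an induced subgraph $R$ of $G$ let $N_R(c,x)=N(c,x)\cap V(R)$ (distances always taken in $G$). Property (P3): there exists an induced subgraph $R$ of $G$ with $N[R]=V(G)$ such that for all $c\in V(R)$, $x\in V(G)$ with $d(c,x)\ge 2$, there exists $c'\in N_R(c,x)$ such that for every $y\in V(G)$ with $d(c',y)\ge 2$, either $d(c,y)=d(c,c')+d(c',y)$ or $d(x,y)=d(x,c')+d(c',y)$. A block graph is a connected graph in which every block (maximal 2-connected subgraph) is complete. An extended block graph is a connected graph obtained from a block graph by replacing each cut vertex by a clique and joining every vertex of that clique to every neighbour of the replaced cut vertex. A simple connected graph $G$ is a vertebrate graph if it has an induced subgraph $B$ (the backbone) such that $B$ is an extended block graph, and for all $c\in V(B)$, $x\in V(G)$ with $d(c,x)\ge 2$ there exists $c'\in N_B(c,x)$ with $N[c']\supseteq N[v]$ for all $v\in N(c,x)$. -}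

module Defs where

open import Data.Nat using (ℕ; zero; suc; _+_; _≤_)
open import Data.Fin using (Fin) renaming (_≟_ to _≟ᶠ_)
open import Data.Fin.Subset using (Subset; _∈_; _⊆_; _-_; ⊤)
open import Data.Fin.Properties using (any?)
open import Data.Product using (Σ; ∃; ∃-syntax; _×_; _,_)
open import Data.Sum using (_⊎_)
open import Relation.Nullary using (¬_; Dec; yes; no)
open import Relation.Nullary.Decidable using (_×-dec_)
open import Relation.Binary.PropositionalEquality using (_≡_; _≢_)
open import Function.Bundles using (_⇔_)

record Graph (n : ℕ) : Set₁ where
  field
    Adj    : Fin n → Fin n → Set
    adj?   : ∀ u v → Dec (Adj u v)
    sym    : ∀ {u v} → Adj u v → Adj v u
    irrefl : ∀ {u} → ¬ Adj u u
open Graph public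

module _ {n : ℕ} (G : Graph n) where

  data WalkIn (S : Subset n) : Fin n → Fin n → Set where
    here : ∀ {u} → u ∈ S → WalkIn S u u
    step : ∀ {u w v} → u ∈ S → Adj G u w → WalkIn S w v → WalkIn S u v

  -- the induced subgraph G[S] is connected (vacuous for S empty)
  ConnectedOn : Subset n → Set
  ConnectedOn S = ∀ u v → u ∈ S → v ∈ S → WalkIn S u v

  Connected : Set
  Connected = ConnectedOn ⊤

  CutVertex : Fin n → Set
  CutVertex v = ¬ ConnectedOn (⊤ - v)

  NoCutVertexOn : Subset n → Set
  NoCutVertexOn S = ConnectedOn S × (∀ v → v ∈ S → ConnectedOn (S - v))

  -- S spans a block: a maximal connected subgraph without cut vertex
  -- (maximal 2-connected subgraph, K₂ and K₁ included as usual)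
  IsBlock : Subset n → Set
  IsBlock S = NoCutVertexOn S × (∀ S' → S ⊆ S' → NoCutVertexOn S' → S' ⊆ S)

  WalkLen : ℕ → Fin n → Fin n → Set
  WalkLen zero    u v = u ≡ v
  WalkLen (suc k) u v = ∃[ w ] (Adj G u w × WalkLen k w v)

  walkLen? : ∀ k u v → Dec (WalkLen k u v)
  walkLen? zero    u v = u ≟ᶠ v
  walkLen? (suc k) u v = any? (λ w → adj? G u w ×-dec walkLen? k w v)

  private
    search : ℕ → ℕ → Fin n → Fin n → ℕ
    search zero       k u v = k
    search (suc fuel) k u v with walkLen? k u v
    ... | yes _ = k
    ... | no  _ = search fuel (suc k) u v

  -- d(u,v): the least length of a walk from u to v.  In a connected
  -- graph on n vertices such a walk of length < n exists, so the search
  -- over k = 0 … n is exhaustive.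
  dist : Fin n → Fin n → ℕ
  dist u v = search n 0 u v

  InClosedNbhd : Fin n → Fin n → Set
  InClosedNbhd v w = v ≡ w ⊎ Adj G v w

  InNcx : Fin n → Fin n → Fin n → Set
  InNcx c x v = Adj G c v × dist c x ≡ suc (dist v x)

  P3 : Set
  P3 = Σ (Subset n) λ R →
         (∀ v → ∃[ r ] (r ∈ R × InClosedNbhd r v))
       × (∀ c x → c ∈ R → 2 ≤ dist c x →
            ∃[ c' ] (c' ∈ R × InNcx c x c' ×
              (∀ y → 2 ≤ dist c' y →
                   dist c y ≡ dist c c' + dist c' y
                 ⊎ dist x y ≡ dist x c' + dist c' y)))

BlockGraph : ∀ {m} → Graph (suc m) → Set
BlockGraph T = Connected T
  × (∀ S → IsBlock T S → ∀ u v → u ∈ S → v ∈ S → u ≢ v → Adj T u v)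

-- The induced subgraph G[B] is an extended block graph: it arises from a
-- block graph T by replacing every cut vertex t of T by a (nonempty)
-- clique φ⁻¹(t), each of whose vertices is joined to every vertex that
-- replaces a neighbour of t; non-cut vertices are kept as single vertices.
ExtendedBlockGraphOn : ∀ {n} → Graph n → Subset n → Set₁
ExtendedBlockGraphOn {n} G B =
  Σ ℕ λ m → Σ (Graph (suc m)) λ T → Σ (Fin n → Fin (suc m)) λ φ →
      BlockGraph T
    × (∀ t → ∃[ u ] (u ∈ B × φ u ≡ t))
    × (∀ u v → u ∈ B → v ∈ B → u ≢ v →
         Adj G u v ⇔ (φ u ≡ φ v ⊎ Adj T (φ u) (φ v)))
    × (∀ u v → u ∈ B → v ∈ B → φ u ≡ φ v → ¬ CutVertex T (φ u) → u ≡ v)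

Vertebrate : ∀ {n} → Graph n → Set₁
Vertebrate {n} G = Σ (Subset n) λ B →
    ExtendedBlockGraphOn G B
  × (∀ c x → c ∈ B → 2 ≤ dist G c x →
       ∃[ c' ] (c' ∈ B × InNcx G c x c' ×
         (∀ v → InNcx G c x v → ∀ w → InClosedNbhd G v w → InClosedNbhd G c' w)))

-- Write N[w] ⊇ N[u] as "w dominates u".  Deleting from R (or from the backbone) a vertex dominated
-- by another of its vertices preserves both local conditions, so both may be assumed thin: no
-- vertex dominates another one.  In a thin set N_R(c,x) has a single element.
-- P3 ⇒ vertebrate: the P3 condition at (c,x) implies the domination condition at (c,x), and for
-- nonadjacent u, v in a thin R the vertex chosen for (u,v) separates u from v in G[R], so every
-- block of G[R] is complete.
-- Vertebrate ⇒ P3: for c, c' in R adjacent, call y behind c' if d(c',y) < d(c,y).  The block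
-- structure forbids edges of R - c' between the vertices behind c' and the others.  Passing to
-- neighbours in R, a geodesic of G leaving the vertices behind c' must do so at c', or at a
-- neighbour of c' towards a vertex dominated by c', and may hence be rerouted through c'.
module Submission where

open import Defs renaming (sym to adj-sym)
open import Data.Empty using (⊥)
open import Data.Fin using (Fin; zero; suc) renaming (_≟_ to _≟ᶠ_)
open import Data.Fin.Properties using (any?; all?)
open import Data.Fin.Subset
  using (Subset; Nonempty; inside; outside; _∈_; _∉_; _⊆_; _⊂_; _⊃_; _∪_; _-_; ⁅_⁆; ⊤; ∣_∣)
open import Data.Fin.Subset.Induction using (Acc; acc; ⊂-wellFounded; ⊃-wellFounded)
open import Data.Fin.Subset.Properties
open import Data.Nat
open import Data.Nat.Properties
open import Data.Product using (∃-syntax; _×_; _,_; proj₁; proj₂)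
open import Data.Sum using (_⊎_; inj₁; inj₂)
open import Data.Vec using (_∷_; here; there)
open import Function using (_∘_; id; _⇔_; mk⇔; Equivalence)
open import Relation.Binary.PropositionalEquality
open import Relation.Nullary using (¬_; Dec; yes; no; contradiction)
open import Relation.Nullary.Decidable using (_×-dec_; _→-dec_; _⊎-dec_; ¬?; decidable-stable)

-- Membership in finite subsets.

x∉p-x : ∀ {n} (p : Subset n) x → x ∉ p - x
x∉p-x (_ ∷ p) zero    ()
x∉p-x (_ ∷ p) (suc x) (there q) = x∉p-x p x q

x∈p-y⇒x≢y : ∀ {n} {p : Subset n} {x y} → x ∈ p - y → x ≢ y
x∈p-y⇒x≢y {p = p} {x} x∈p-y refl = x∉p-x p x x∈p-y

x∈p-y⇒x∈p : ∀ {n} {p : Subset n} {x} y → x ∈ p - y → x ∈ p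
x∈p-y⇒x∈p {p = p} y = p─q⊆p p ⁅ y ⁆

∈-head : ∀ {n} {u : Fin n} P → u ∈ ⁅ u ⁆ ∪ P
∈-head {u = u} P = x∈p∪q⁺ (inj₁ (x∈⁅x⁆ u))

∈-tail : ∀ {n} {u z : Fin n} {P} → z ∈ P → z ∈ ⁅ u ⁆ ∪ P
∈-tail z∈P = x∈p∪q⁺ (inj₂ z∈P)

∈-cases : ∀ {n} {u z : Fin n} P → z ∈ ⁅ u ⁆ ∪ P → z ≡ u ⊎ z ∈ P
∈-cases {u = u} P z∈ with x∈p∪q⁻ ⁅ u ⁆ P z∈
... | inj₁ z∈u = inj₁ (x∈⁅y⁆⇒x≡y u z∈u)
... | inj₂ z∈P = inj₂ z∈P

-- The search behind dist is private to Defs, so its name is out of reach.  In dist-unfold the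
-- goal mentions it with all arguments abstracted to distinct variables, which solves the
-- metavariable in searchFrom by unification.
mutual
  searchFrom : ∀ {n} → Graph n → ℕ → ℕ → Fin n → Fin n → ℕ
  searchFrom G fuel k u v = _

  private
    dist-unfold : ∀ m (G : Graph (suc m)) u v → u ≢ v → dist G u v ≡ searchFrom G m 1 u v
    dist-unfold m G u v u≢v with u ≟ᶠ v
    ... | yes u≡v = contradiction u≡v u≢v
    ... | no _ with suc m | G | u | v | 1
    ...   | n | H | x | y | k = refl

module _ {n : ℕ} (G : Graph n) where

  -- Correctness of the distance search.

  searchFrom-least : ∀ fuel k {j u v} → k ≤ j → WalkLen G j u v → searchFrom G fuel k u v ≤ j
  searchFrom-least zero k k≤j _ = k≤j
  searchFrom-least (suc fuel) k {j} {u} {v} k≤j p with walkLen? G k u v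
  ... | yes _ = k≤j
  ... | no ¬q with m≤n⇒m<n∨m≡n k≤j
  ...   | inj₁ k<j  = searchFrom-least fuel (suc k) k<j p
  ...   | inj₂ refl = contradiction p ¬q

  searchFrom-found : ∀ fuel k {j u v} → k ≤ j → j ≤ fuel + k → WalkLen G j u v →
                     WalkLen G (searchFrom G fuel k u v) u v
  -- Without fuel the search returns `k` untested; here `k ≤ j ≤ k`, so the given walk already has
  -- that length.
  searchFrom-found zero k k≤j j≤k p = subst (λ i → WalkLen G i _ _) (≤-antisym j≤k k≤j) p
  searchFrom-found (suc fuel) k {j} {u} {v} k≤j j≤ p with walkLen? G k u v
  ... | yes q = q
  ... | no ¬q with m≤n⇒m<n∨m≡n k≤j
  ...   | inj₁ k<j  = searchFrom-found fuel (suc k) k<j (subst (j ≤_) (sym (+-suc fuel k)) j≤) p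
  ...   | inj₂ refl = contradiction p ¬q

  -- Walks, simple paths, cycles and blocks.

  walk-mono : ∀ {S S' u v} → S ⊆ S' → WalkIn G S u v → WalkIn G S' u v
  walk-mono S⊆S' (here u∈S)     = here (S⊆S' u∈S)
  walk-mono S⊆S' (step u∈S a p) = step (S⊆S' u∈S) a (walk-mono S⊆S' p)

  walk-trans : ∀ {S u v w} → WalkIn G S u v → WalkIn G S v w → WalkIn G S u w
  walk-trans (here _)       q = q
  walk-trans (step u∈S a p) q = step u∈S a (walk-trans p q)

  walk-start : ∀ {S u v} → WalkIn G S u v → u ∈ S
  walk-start (here u∈S)     = u∈S
  walk-start (step u∈S _ _) = u∈S

  walk-reverse : ∀ {S u v} → WalkIn G S u v → WalkIn G S v u
  walk-reverse (here u∈S)     = here u∈S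
  walk-reverse (step u∈S a p) =
    walk-trans (walk-reverse p) (step (walk-start p) (adj-sym G a) (here u∈S))

  star-connected : ∀ {S} t → (∀ {z} → z ∈ S → WalkIn G S z t) → ConnectedOn G S
  star-connected t toT u v u∈S v∈S = walk-trans (toT u∈S) (walk-reverse (toT v∈S))

  -- Indexing by the exact set of visited vertices makes simplicity the side condition `u ∉ P` and
  -- lets the cardinality of `P` bound the length.
  data Path : Subset n → Fin n → Fin n → Set where
    stop : ∀ {u} → Path ⁅ u ⁆ u u
    cons : ∀ {P u w v} → Adj G u w → u ∉ P → Path P w v → Path (⁅ u ⁆ ∪ P) u v

  path-start : ∀ {P u v} → Path P u v → u ∈ P
  path-start {u = u} stop           = x∈⁅x⁆ u
  path-start         (cons _ _ p) = ∈-head _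

  path-suffix : ∀ {P u v z} → Path P u v → z ∈ P → ∃[ Q ] (Q ⊆ P × Path Q z v)
  path-suffix {u = u} stop z∈ with x∈⁅y⁆⇒x≡y u z∈
  ... | refl = _ , id , stop
  path-suffix p@(cons {P} a u∉P q) z∈ with ∈-cases P z∈
  ... | inj₁ refl = _ , id , p
  ... | inj₂ z∈P with path-suffix q z∈P
  ...   | Q , Q⊆P , r = Q , ∈-tail ∘ Q⊆P , r

  walk⇒path : ∀ {S u v} → WalkIn G S u v → ∃[ P ] (P ⊆ S × Path P u v)
  walk⇒path {u = u} (here u∈S) = ⁅ u ⁆ , (λ x∈ → subst (_∈ _) (sym (x∈⁅y⁆⇒x≡y u x∈)) u∈S) , stop
  walk⇒path {S} {u = u} (step u∈S a w) with walk⇒path w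
  ... | P , P⊆S , p with u ∈? P
  ...   | no u∉P = _ , incl , cons a u∉P p
    where
    incl : ⁅ u ⁆ ∪ P ⊆ S
    incl x∈ with ∈-cases P x∈
    ... | inj₁ refl = u∈S
    ... | inj₂ x∈P  = P⊆S x∈P
  ...   | yes u∈P with path-suffix p u∈P
  ...     | Q , Q⊆P , q = Q , P⊆S ∘ Q⊆P , q

  path-length : ∀ {P u v} → Path P u v → ∃[ k ] (k < ∣ P ∣ × WalkLen G k u v)
  path-length {u = u} stop = 0 , ≤-reflexive (sym (∣⁅x⁆∣≡1 u)) , refl
  path-length {u = u} (cons {P} a u∉P p) with path-length p
  ... | k , k<P , w = suc k , <-≤-trans (s<s k<P) (p⊂q⇒∣p∣<∣q∣ P⊂uP) , (_ , a , w)
    where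
    P⊂uP : P ⊂ ⁅ u ⁆ ∪ P
    P⊂uP = ∈-tail , u , ∈-head P , u∉P

  path-walk : ∀ {P u v z} → Path P u v → z ∈ P → WalkIn G P z v
  path-walk {u = u} stop z∈ with x∈⁅y⁆⇒x≡y u z∈
  ... | refl = here z∈
  path-walk (cons {P} a _ p) z∈ with ∈-cases P z∈
  ... | inj₁ refl = step z∈ a (walk-mono ∈-tail (path-walk p (path-start p)))
  ... | inj₂ z∈P  = walk-mono ∈-tail (path-walk p z∈P)

  -- A simple path meets `r` at most once, so one of the two stretches from `z` to the ends misses
  -- it.
  path-minus : ∀ {P u v z} r → Path P u v → z ∈ P → z ≢ r →
               WalkIn G (P - r) z u ⊎ WalkIn G (P - r) z v
  path-minus {u = u} r stop z∈ z≢r with x∈⁅y⁆⇒x≡y u z∈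
  ... | refl = inj₁ (here (x∈p∧x≢y⇒x∈p-y z∈ z≢r))
  path-minus {u = u} r (cons {P} {w = w} a u∉P p) z∈ z≢r with ∈-cases P z∈ | u ≟ᶠ r
  ... | inj₁ refl | _ = inj₁ (here (x∈p∧x≢y⇒x∈p-y z∈ z≢r))
  ... | inj₂ z∈P | yes refl = inj₂ (walk-mono P⊆ (path-walk p z∈P))
    where
    P⊆ : P ⊆ (⁅ u ⁆ ∪ P) - u
    P⊆ x∈P = x∈p∧x≢y⇒x∈p-y (∈-tail x∈P) (λ { refl → u∉P x∈P })
  ... | inj₂ z∈P | no u≢r with path-minus r p z∈P z≢r
  ...   | inj₂ q = inj₂ (walk-mono P-r⊆ q)
    where
    P-r⊆ : P - r ⊆ (⁅ u ⁆ ∪ P) - r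
    P-r⊆ x∈ = x∈p∧x≢y⇒x∈p-y (∈-tail (x∈p-y⇒x∈p r x∈)) (x∈p-y⇒x≢y x∈)
  ...   | inj₁ q = inj₁ (walk-trans (walk-mono P-r⊆ q)
                     (step (P-r⊆ (walk-start (walk-reverse q))) (adj-sym G a)
                       (here (x∈p∧x≢y⇒x∈p-y (∈-head P) u≢r))))
    where
    P-r⊆ : P - r ⊆ (⁅ u ⁆ ∪ P) - r
    P-r⊆ x∈ = x∈p∧x≢y⇒x∈p-y (∈-tail (x∈p-y⇒x∈p r x∈)) (x∈p-y⇒x≢y x∈)

  -- Deleting `t` leaves the path; deleting a path vertex leaves pieces that each still contain a
  -- neighbour `a` or `b` of `t`.
  cycle-noCutVertex : ∀ {P a b t} → Path P a b → t ∉ P → Adj G t a → Adj G t b →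
                      NoCutVertexOn G (⁅ t ⁆ ∪ P)
  cycle-noCutVertex {P} {a} {b} {t} p t∉P ta tb = star-connected t toT , avoid
    where
    toB : ∀ {z} → z ∈ P → WalkIn G P z b
    toB = path-walk p

    toT : ∀ {z} → z ∈ ⁅ t ⁆ ∪ P → WalkIn G (⁅ t ⁆ ∪ P) z t
    toT z∈ with ∈-cases P z∈
    ... | inj₁ refl = here z∈
    ... | inj₂ z∈P  = walk-trans (walk-mono ∈-tail (toB z∈P))
      (step (∈-tail (walk-start (walk-reverse (toB z∈P)))) (adj-sym G tb) (here (∈-head P)))

    avoid : ∀ r → r ∈ ⁅ t ⁆ ∪ P → ConnectedOn G ((⁅ t ⁆ ∪ P) - r)
    avoid r _ with t ≟ᶠ r
    ... | yes refl = star-connected b toB'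
      where
      P⊆ : P ⊆ (⁅ t ⁆ ∪ P) - t
      P⊆ x∈P = x∈p∧x≢y⇒x∈p-y (∈-tail x∈P) (λ { refl → t∉P x∈P })

      toB' : ∀ {z} → z ∈ (⁅ t ⁆ ∪ P) - t → WalkIn G ((⁅ t ⁆ ∪ P) - t) z b
      toB' z∈ with ∈-cases P (x∈p-y⇒x∈p t z∈)
      ... | inj₁ refl = contradiction refl (x∈p-y⇒x≢y z∈)
      ... | inj₂ z∈P  = walk-mono P⊆ (toB z∈P)
    ... | no t≢r = star-connected t toT'
      where
      P-r⊆ : P - r ⊆ (⁅ t ⁆ ∪ P) - r
      P-r⊆ x∈ = x∈p∧x≢y⇒x∈p-y (∈-tail (x∈p-y⇒x∈p r x∈)) (x∈p-y⇒x≢y x∈)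

      exit : ∀ {z w} → Adj G t w → WalkIn G (P - r) z w → WalkIn G ((⁅ t ⁆ ∪ P) - r) z t
      exit tw q = walk-trans (walk-mono P-r⊆ q)
        (step (P-r⊆ (walk-start (walk-reverse q))) (adj-sym G tw)
          (here (x∈p∧x≢y⇒x∈p-y (∈-head P) t≢r)))

      toT' : ∀ {z} → z ∈ (⁅ t ⁆ ∪ P) - r → WalkIn G ((⁅ t ⁆ ∪ P) - r) z t
      toT' z∈ with ∈-cases P (x∈p-y⇒x∈p r z∈)
      ... | inj₁ refl = here z∈
      ... | inj₂ z∈P with path-minus r p z∈P (x∈p-y⇒x≢y z∈)
      ...   | inj₁ q = exit ta q
      ...   | inj₂ q = exit tb q

  -- If no block contained `S`, then any strictly larger set without cut vertex would, by induction,
  -- yield one; so `S` itself would be maximal. The double negation spares deciding whether a larger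
  -- set exists and is harmless when the goal is a decidable adjacency.
  block-extension : ∀ {S} → NoCutVertexOn G S → ¬ ¬ (∃[ S' ] (S ⊆ S' × IsBlock G S'))
  block-extension {S} = go S (⊃-wellFounded S)
    where
    go : ∀ S → Acc _⊃_ S → NoCutVertexOn G S → ¬ ¬ (∃[ S' ] (S ⊆ S' × IsBlock G S'))
    go S (acc rec) nc none = none (S , id , nc , maximal)
      where
      maximal : ∀ S' → S ⊆ S' → NoCutVertexOn G S' → S' ⊆ S
      maximal S' S⊆S' nc' {x} x∈S' with x ∈? S
      ... | yes x∈S = x∈S
      ... | no  x∉S = contradiction
        (λ { (S″ , S'⊆S″ , bl) → none (S″ , S'⊆S″ ∘ S⊆S' , bl) })
        (go S' (rec (S⊆S' , x , x∈S' , x∉S)) nc')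

-- A simple path from a to b avoiding t closes up at t to a cycle, which lies in a block.
block-neighbours : ∀ {m} (T : Graph (suc m)) → BlockGraph T → ∀ {t a b} →
                   Adj T t a → Adj T t b → WalkIn T (⊤ - t) a b → a ≡ b ⊎ Adj T a b
block-neighbours T (_ , complete) {t} {a} {b} ta tb walk =
  decidable-stable (a ≟ᶠ b ⊎-dec adj? T a b) λ neither →
    let P , P⊆ , p = walk⇒path T walk
        t∉P : t ∉ P
        t∉P = x∉p-x ⊤ t ∘ P⊆
        b∈P : b ∈ P
        b∈P = walk-start T (walk-reverse T (path-walk T p (path-start T p)))
    in block-extension T (cycle-noCutVertex T p t∉P ta tb)
         λ { (S , P⊆S , bl) → neither (inj₂ (complete S bl a b
               (P⊆S (∈-tail (path-start T p))) (P⊆S (∈-tail b∈P)) (neither ∘ inj₁))) }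

-- Numbering the vertices of a nonempty set.

record Enumeration {n} (R : Subset n) : Set where
  field
    {size}  : ℕ
    element : Fin (suc size) → Fin n
    index   : Fin n → Fin (suc size)
    element-∈     : ∀ t → element t ∈ R
    index-element : ∀ t → index (element t) ≡ t
    element-index : ∀ {u} → u ∈ R → element (index u) ≡ u

-- Transports `R` to a type `Fin (suc size)`, the form in which block graphs are given. Off `R` the
-- values of `index` are arbitrary.
enumerate : ∀ {n} (R : Subset n) → Nonempty R → Enumeration R
enumerate (outside ∷ R) (suc x , there x∈R) = record
  { element       = suc ∘ element
  ; index         = λ { zero → zero ; (suc u) → index u }
  ; element-∈     = there ∘ element-∈
  ; index-element = index-element
  ; element-index = λ { (there u∈R) → cong suc (element-index u∈R) }
  }
  where open Enumeration (enumerate R (x , x∈R))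
enumerate (inside ∷ R) _ with nonempty? R
... | no empty = record
  { size          = 0
  ; element       = λ _ → zero
  ; index         = λ _ → zero
  ; element-∈     = λ _ → here
  ; index-element = λ { zero → refl }
  ; element-index = λ { here → refl ; (there u∈R) → contradiction (_ , u∈R) empty }
  }
... | yes ne = record
  { element       = λ { zero → zero ; (suc t) → suc (element t) }
  ; index         = λ { zero → zero ; (suc u) → suc (index u) }
  ; element-∈     = λ { zero → here ; (suc t) → there (element-∈ t) }
  ; index-element = λ { zero → refl ; (suc t) → cong suc (index-element t) }
  ; element-index = λ { here → refl ; (there u∈R) → cong suc (element-index u∈R) }
  }
  where open Enumeration (enumerate R ne)

-- The metric of a connected graph.

module Metric {n : ℕ} (G : Graph n) (conn : Connected G) where

  d : Fin n → Fin n → ℕ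
  d = dist G

  -- Connectedness gives a simple path, whose length is below `n` and hence within reach of the
  -- search.
  d-walk : ∀ u v → WalkLen G (d u v) u v
  d-walk u v with walk⇒path G (conn u v ∈⊤ ∈⊤)
  ... | P , _ , p with path-length G p
  ...   | k , k<P , w = searchFrom-found G n 0 z≤n
    (subst (k ≤_) (sym (+-identityʳ n)) (<⇒≤ (<-≤-trans k<P (∣p∣≤n P)))) w

  d-least : ∀ {k u v} → WalkLen G k u v → d u v ≤ k
  d-least = searchFrom-least G n 0 z≤n

  walkLen-trans : ∀ j {k u v w} → WalkLen G j u v → WalkLen G k v w → WalkLen G (j + k) u w
  walkLen-trans zero    refl        q = q
  walkLen-trans (suc j) (_ , a , p) q = _ , a , walkLen-trans j p q

  walkLen-reverse : ∀ k {u v} → WalkLen G k u v → WalkLen G k v u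
  walkLen-reverse zero    refl        = refl
  walkLen-reverse (suc k) {u} {v} (_ , a , p) =
    subst (λ j → WalkLen G j v u) (+-comm k 1)
      (walkLen-trans k (walkLen-reverse k p) (u , adj-sym G a , refl))

  triangle : ∀ u v w → d u w ≤ d u v + d v w
  triangle u v w = d-least (walkLen-trans (d u v) (d-walk u v) (d-walk v w))

  d-sym : ∀ u v → d u v ≡ d v u
  d-sym u v = ≤-antisym (half u v) (half v u)
    where
    half : ∀ u v → d u v ≤ d v u
    half u v = d-least (walkLen-reverse (d v u) (d-walk v u))

  d-refl : ∀ u → d u u ≡ 0
  d-refl u = n≤0⇒n≡0 (d-least refl)

  d≡0⇒≡ : ∀ {u v} → d u v ≡ 0 → u ≡ v
  d≡0⇒≡ {u} {v} eq = subst (λ k → WalkLen G k u v) eq (d-walk u v)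

  d≡1⇒adj : ∀ {u v} → d u v ≡ 1 → Adj G u v
  d≡1⇒adj {u} {v} eq with subst (λ k → WalkLen G k u v) eq (d-walk u v)
  ... | _ , a , refl = a

  adj⇒d≡1 : ∀ {u v} → Adj G u v → d u v ≡ 1
  adj⇒d≡1 {u} {v} a = ≤-antisym (d-least (v , a , refl))
    (n≢0⇒n>0 λ eq → irrefl G (subst (λ w → Adj G w v) (d≡0⇒≡ eq) a))

  adj⇒≢ : ∀ {u v} → Adj G u v → u ≢ v
  adj⇒≢ a refl = irrefl G a

  ≢⇒d>0 : ∀ {u v} → u ≢ v → 0 < d u v
  ≢⇒d>0 u≢v = n≢0⇒n>0 (u≢v ∘ d≡0⇒≡)

  d>0⇒≢ : ∀ {u v} → 0 < d u v → u ≢ v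
  d>0⇒≢ {u} pos refl = <⇒≢ pos (sym (d-refl u))

  adj-triangle : ∀ {u w} v → Adj G u w → d u v ≤ suc (d w v)
  adj-triangle {u} {w} v a = subst (λ k → d u v ≤ k + d w v) (adj⇒d≡1 a) (triangle u w v)

  adj-triangleʳ : ∀ {u w} v → Adj G u w → d v u ≤ suc (d v w)
  adj-triangleʳ {u} {w} v a = subst₂ (λ j k → j ≤ suc k) (d-sym u v) (d-sym w v) (adj-triangle v a)

  d≤1⇒closed : ∀ {u v} → d u v ≤ 1 → InClosedNbhd G u v
  d≤1⇒closed {u} {v} le with m≤n⇒m<n∨m≡n le
  ... | inj₁ lt = inj₁ (d≡0⇒≡ (n<1⇒n≡0 lt))
  ... | inj₂ eq = inj₂ (d≡1⇒adj eq)

  closed⇒d≤1 : ∀ {u v} → InClosedNbhd G u v → d u v ≤ 1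
  closed⇒d≤1 {u} (inj₁ refl) = subst (_≤ 1) (sym (d-refl u)) z≤n
  closed⇒d≤1 (inj₂ a)    = ≤-reflexive (adj⇒d≡1 a)

  closed? : ∀ u v → Dec (InClosedNbhd G u v)
  closed? u v = u ≟ᶠ v ⊎-dec adj? G u v

  ¬closed⇒2≤d : ∀ {u v} → ¬ InClosedNbhd G u v → 2 ≤ d u v
  ¬closed⇒2≤d ¬cl = ≰⇒> (¬cl ∘ d≤1⇒closed)

  d-next : ∀ {u v k} → d u v ≡ suc k → ∃[ w ] (Adj G u w × d w v ≡ k)
  d-next {u} {v} {k} eq with subst (λ j → WalkLen G j u v) eq (d-walk u v)
  ... | w , a , p = w , a , ≤-antisym (d-least p)
    (s≤s⁻¹ (subst (_≤ suc (d w v)) eq (adj-triangle v a)))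

  -- Along an edge the distance to `x` drops by at most one, so a strict drop is a drop by exactly
  -- one.
  ncx : ∀ {c x v} → Adj G c v → d v x < d c x → InNcx G c x v
  ncx {x = x} a lt = a , ≤-antisym (adj-triangle x a) lt

  -- Domination and the two local conditions.

  Dominates : Fin n → Fin n → Set
  Dominates w u = ∀ z → InClosedNbhd G u z → InClosedNbhd G w z

  dominates? : ∀ w u → Dec (Dominates w u)
  dominates? w u = all? (λ z → closed? u z →-dec closed? w z)

  -- The first step of a geodesic from `u` to `y` stays in the closed neighbourhood of `w`, so `w`
  -- can follow the same geodesic.
  dominates-d : ∀ {w u y} → Dominates w u → u ≢ y → d w y ≤ d u y
  dominates-d {w} {u} {y} dom u≢y with d u y in eq
  ... | zero  = contradiction (d≡0⇒≡ eq) u≢y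
  ... | suc k with d-next eq
  ...   | z , a , refl with dom z (inj₂ a)
  ...     | inj₁ refl = n≤1+n _
  ...     | inj₂ b    = adj-triangle y b

  -- As `c` is a neighbour of `u`, it equals `w` or is adjacent to `w`; equality fails because `w`
  -- is no farther from `x` than `u`.
  ncx-dominates : ∀ {c x u w} → 2 ≤ d c x → InNcx G c x u → Dominates w u → InNcx G c x w
  ncx-dominates {c} {x} {u} {w} 2≤ (cu , eq) dom with dom c (inj₂ (adj-sym G cu))
  ... | inj₁ refl = contradiction (subst (_≤ d u x) eq le) (n≮n _)
    where
    le : d c x ≤ d u x
    le = dominates-d dom (d>0⇒≢ (s≤s⁻¹ (subst (2 ≤_) eq 2≤)))
  ... | inj₂ wc = ncx (adj-sym G wc) (subst (d w x <_) (sym eq) (s≤s le))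
    where
    le : d w x ≤ d u x
    le = dominates-d dom (d>0⇒≢ (s≤s⁻¹ (subst (2 ≤_) eq 2≤)))

  -- The (P3) and vertebrate conditions differ only in what is demanded of `c'`; abstracting over
  -- this demand lets thinning and descent serve both.
  Selection : Set₁
  Selection = Fin n → Fin n → Fin n → Set

  Selects : Selection → Subset n → Set
  Selects Q R = ∀ c x → c ∈ R → 2 ≤ d c x → ∃[ c' ] (c' ∈ R × InNcx G c x c' × Q c x c')

  Separating Dominating : Selection
  Separating c x c' = ∀ y → 2 ≤ d c' y → d c y ≡ d c c' + d c' y ⊎ d x y ≡ d x c' + d c' y
  Dominating c x c' = ∀ v → InNcx G c x v → Dominates c' v

  Monotone : Selection → Set
  Monotone Q = ∀ {c x u w} → InNcx G c x u → InNcx G c x w → Dominates w u → Q c x u → Q c x w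

  dominating-mono : Monotone Dominating
  dominating-mono _ _ dom q v v∈ z vz = dom z (q v v∈ z vz)

  -- Both `u` and `w` have the same distances to `c` and to `x`, and `w` is no farther from `y`; so
  -- a geodesic through `u` can be exchanged for one through `w`.
  separating-mono : Monotone Separating
  separating-mono {c} {x} {u} {w} (cu , equ) (cw , eqw) dom q y 2≤ = go (q y (≤-trans 2≤ le))
    where
    u≢y : u ≢ y
    u≢y refl = contradiction (≤-trans 2≤ (closed⇒d≤1 (dom u (inj₁ refl)))) (n≮n 1)

    le : d w y ≤ d u y
    le = dominates-d dom u≢y

    xw≡xu : d x w ≡ d x u
    xw≡xu = trans (d-sym x w) (trans (suc-injective (trans (sym eqw) equ)) (d-sym u x))

    cw≡cu : d c w ≡ d c u
    cw≡cu = trans (adj⇒d≡1 cw) (sym (adj⇒d≡1 cu))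

    improve : ∀ {z} → d z w ≡ d z u → d z y ≡ d z u + d u y → d z y ≡ d z w + d w y
    improve {z} zw≡zu eq = ≤-antisym (triangle z w y)
      (≤-trans (+-mono-≤ (≤-reflexive zw≡zu) le) (≤-reflexive (sym eq)))

    go : d c y ≡ d c u + d u y ⊎ d x y ≡ d x u + d u y →
         d c y ≡ d c w + d w y ⊎ d x y ≡ d x w + d w y
    go (inj₁ eq) = inj₁ (improve cw≡cu eq)
    go (inj₂ eq) = inj₂ (improve xw≡xu eq)

  -- A vertex `w` of N[v] outside N[c'] would have distance at least 3 from `c` or at least
  -- `d x c' + 2` from `x`, while the route through `v` is shorter than either.
  separating⇒dominating : ∀ {c x c'} → InNcx G c x c' → Separating c x c' → Dominating c x c'
  separating⇒dominating {c} {x} {c'} (cc' , eq') sep v (cv , eq) w vw =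
    decidable-stable (closed? c' w) λ ¬cl → refute (¬closed⇒2≤d ¬cl) (sep w (¬closed⇒2≤d ¬cl))
    where
    open ≤-Reasoning
    xv≡xc' : d x v ≡ d x c'
    xv≡xc' = trans (d-sym x v) (trans (suc-injective (trans (sym eq) eq')) (d-sym c' x))

    refute : 2 ≤ d c' w → ¬ (d c w ≡ d c c' + d c' w ⊎ d x w ≡ d x c' + d c' w)
    refute 2≤ (inj₁ e) = n≮n 2 (begin
      3                ≤⟨ +-mono-≤ (≤-reflexive (sym (adj⇒d≡1 cc'))) 2≤ ⟩
      d c c' + d c' w  ≡⟨ e ⟨
      d c w            ≤⟨ adj-triangle w cv ⟩
      suc (d v w)      ≤⟨ s≤s (closed⇒d≤1 vw) ⟩
      2                ∎)
    refute 2≤ (inj₂ e) = n≮n 1 (+-cancelˡ-≤ (d x c') 2 1 (begin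
      d x c' + 2       ≤⟨ +-monoʳ-≤ (d x c') 2≤ ⟩
      d x c' + d c' w  ≡⟨ e ⟨
      d x w            ≤⟨ triangle x v w ⟩
      d x v + d v w    ≤⟨ +-mono-≤ (≤-reflexive xv≡xc') (closed⇒d≤1 vw) ⟩
      d x c' + 1       ∎))

  -- Thinning by deleting dominated vertices.

  Thin : Subset n → Set
  Thin R = ∀ u w → u ∈ R → w ∈ R → Dominates w u → u ≡ w

  remove-dominated : ∀ {Q R u w} → Monotone Q → Selects Q R → w ∈ R → w ≢ u → Dominates w u →
                     Selects Q (R - u)
  remove-dominated {Q} {R} {u} {w} mono sel w∈R w≢u dom c x c∈ 2≤
    with sel c x (x∈p-y⇒x∈p u c∈) 2≤
  ... | c' , c'∈R , N , q with c' ≟ᶠ u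
  ...   | no c'≢u  = c' , x∈p∧x≢y⇒x∈p-y c'∈R c'≢u , N , q
  ...   | yes refl = w , x∈p∧x≢y⇒x∈p-y w∈R w≢u , N' , mono N N' dom q
    where
    N' : InNcx G c x w
    N' = ncx-dominates 2≤ N dom

  thin : ∀ {Q} → Monotone Q → ∀ R → Nonempty R → Selects Q R →
         ∃[ R' ] (R' ⊆ R × Nonempty R' × Selects Q R' × Thin R')
  thin {Q} mono R = go R (⊂-wellFounded R)
    where
    go : ∀ R → Acc _⊂_ R → Nonempty R → Selects Q R →
         ∃[ R' ] (R' ⊆ R × Nonempty R' × Selects Q R' × Thin R')
    go R (acc rec) ne sel with any? (λ u → any? (λ w →
      u ∈? R ×-dec w ∈? R ×-dec dominates? w u ×-dec ¬? (w ≟ᶠ u)))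
    ... | no none = R , id , ne , sel , λ u w u∈R w∈R dom →
      decidable-stable (u ≟ᶠ w) λ u≢w → none (u , w , u∈R , w∈R , dom , u≢w ∘ sym)
    ... | yes (u , w , u∈R , w∈R , dom , w≢u)
      with go (R - u) (rec (x∈p⇒p-x⊂p u∈R)) (w , x∈p∧x≢y⇒x∈p-y w∈R w≢u)
              (remove-dominated mono sel w∈R w≢u dom)
    ...   | R' , R'⊆ , rest = R' , x∈p-y⇒x∈p u ∘ R'⊆ , rest

  -- Moving inside a set with selections.

  module Selected {Q R} (sel : Selects Q R) where

    -- Iterating the selection follows a geodesic until `x` is within distance one. This replaces
    -- arbitrary vertices by nearby vertices of `R`, and shows that a nonempty `R` dominates `G`.
    descend : ∀ {c} x → c ∈ R → ∃[ r ] (r ∈ R × d r x ≤ 1 × d c x ≡ d c r + d r x)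
    descend {c} x c∈R = go (d c x) c∈R ≤-refl
      where
      open ≤-Reasoning
      go : ∀ k {c} → c ∈ R → d c x ≤ k → ∃[ r ] (r ∈ R × d r x ≤ 1 × d c x ≡ d c r + d r x)
      go k {c} c∈R le with d c x ≤? 1
      ... | yes ≤1 = c , c∈R , ≤1 , cong (_+ d c x) (sym (d-refl c))
      ... | no ≰1 with sel c x c∈R (≰⇒> ≰1)
      go zero    c∈R le | no ≰1 | _ = contradiction (≤-trans le z≤n) ≰1
      go (suc k) {c} c∈R le | no ≰1 | c' , c'∈R , (cc' , eq) , _
        with go k c'∈R (s≤s⁻¹ (subst (_≤ suc k) eq le))
      ... | r , r∈R , ≤1 , eq' = r , r∈R , ≤1 , ≤-antisym (triangle c r x) (begin
        d c r + d r x         ≤⟨ +-monoˡ-≤ (d r x) (adj-triangle r cc') ⟩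
        suc (d c' r + d r x)  ≡⟨ cong suc eq' ⟨
        suc (d c' x)          ≡⟨ eq ⟨
        d c x                 ∎)

    -- Extends the selection to adjacent `c` and `x`, where the next vertex is `x` itself; iterated,
    -- it yields geodesics of `G` inside `R`.
    toward : ∀ {c x} → c ∈ R → x ∈ R → c ≢ x → ∃[ c' ] (c' ∈ R × InNcx G c x c')
    toward {c} {x} c∈R x∈R c≢x with 2 ≤? d c x
    ... | yes 2≤ = let c' , c'∈R , N , _ = sel c x c∈R 2≤ in c' , c'∈R , N
    ... | no 2≰ = x , x∈R , d≡1⇒adj cx≡1 , trans cx≡1 (cong suc (sym (d-refl x)))
      where
      cx≡1 : d c x ≡ 1
      cx≡1 = ≤-antisym (s≤s⁻¹ (≰⇒> 2≰)) (≢⇒d>0 c≢x)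

  -- Both vertices are dominated by the selected one, so thinness identifies them with it.
  ncx-unique : ∀ {R c x u v} → Thin R → Selects Dominating R → c ∈ R → 2 ≤ d c x →
               u ∈ R → InNcx G c x u → v ∈ R → InNcx G c x v → u ≡ v
  ncx-unique {c = c} {x} {u} {v} thinR sel c∈R 2≤ u∈R Nu v∈R Nv with sel c x c∈R 2≤
  ... | c' , c'∈R , _ , dom = trans (thinR u c' u∈R c'∈R (dom u Nu)) (sym (thinR v c' v∈R c'∈R (dom v Nv)))

  selects-dominating : ∀ {R} → Selects Separating R → Selects Dominating R
  selects-dominating sel c x c∈R 2≤ with sel c x c∈R 2≤
  ... | c' , c'∈R , N , sep = c' , c'∈R , N , separating⇒dominating N sep

  -- From (P3) to vertebrate: a thin set induces a block graph.

  module ThinBlockGraph {R} (thinR : Thin R) (sel : Selects Separating R) where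
    open Selected sel

    selDom : Selects Dominating R
    selDom = selects-dominating sel

    -- Being behind c', as seen from the neighbour u of c', propagates along edges of R avoiding c'.
    behind-step : ∀ {u c' q p} → u ∈ R → c' ∈ R → Adj G u c' → q ∈ R → p ∈ R → q ≢ c' → Adj G q p →
                  d c' q < d u q → d c' p < d u p
    behind-step {u} {c'} {q} {p} u∈R c'∈R uc' q∈R p∈R q≢c' qp behind =
      conclude (toward q∈R c'∈R q≢c') (sel q u q∈R 2≤qu)
      where
      open ≤-Reasoning
      2≤qu : 2 ≤ d q u
      2≤qu = subst (2 ≤_) (d-sym u q) (≤-trans (s≤s (≢⇒d>0 (q≢c' ∘ sym))) behind)

      conclude : ∃[ z₀ ] (z₀ ∈ R × InNcx G q c' z₀) →
                 ∃[ z ] (z ∈ R × InNcx G q u z × Separating q u z) → d c' p < d u p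
      conclude (z₀ , z₀∈R , (qz₀ , eq₀)) (z , z∈R , (qz , eq) , sep) = result
        where
        -- Since `q` is behind `c'`, a step from `q` towards `c'` is also a step towards `u`, and
        -- such a step is unique.
        z₀≡z : z₀ ≡ z
        z₀≡z = ncx-unique thinR selDom q∈R 2≤qu z₀∈R (ncx qz₀ (begin-strict
          d z₀ u         ≤⟨ adj-triangleʳ z₀ uc' ⟩
          suc (d z₀ c')  ≡⟨ eq₀ ⟨
          d q c'         ≡⟨ d-sym q c' ⟩
          d c' q         <⟨ behind ⟩
          d u q          ≡⟨ d-sym u q ⟩
          d q u          ∎)) z∈R (qz , eq)

        c'q≡ : d c' q ≡ suc (d c' z)
        c'q≡ = trans (d-sym c' q) (trans eq₀ (cong suc (trans (d-sym z₀ c') (cong (d c') z₀≡z))))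

        uq≡ : d u q ≡ suc (d u z)
        uq≡ = trans (d-sym u q) (trans eq (cong suc (d-sym z u)))

        result : d c' p < d u p
        -- At `p = z` both distances drop by one. If `p` is adjacent to `z`, uniqueness of `z` keeps
        -- `p` from being nearer to `u` than `q`. Otherwise separation applies to `p`, and only its
        -- alternative at `u` is possible, since `p` is adjacent to `q`.
        result with p ≟ᶠ z
        ... | yes refl = s<s⁻¹ (subst₂ _<_ c'q≡ uq≡ behind)
        ... | no p≢z with closed? z p
        ...   | yes (inj₁ z≡p) = contradiction (sym z≡p) p≢z
        ...   | yes (inj₂ zp) = begin-strict
          d c' p        ≤⟨ adj-triangleʳ c' (adj-sym G zp) ⟩
          suc (d c' z)  ≡⟨ c'q≡ ⟨
          d c' q        <⟨ behind ⟩
          d u q         ≤⟨ ≮⇒≥ (λ up<uq → p≢z (ncx-unique thinR selDom q∈R 2≤qu p∈R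
                             (ncx qp (subst₂ _<_ (d-sym u p) (d-sym u q) up<uq)) z∈R (qz , eq))) ⟩
          d u p         ∎
        ...   | no ¬zp with sep p (¬closed⇒2≤d ¬zp)
        ...     | inj₁ qp≡ = contradiction (begin
          3              ≤⟨ s≤s (¬closed⇒2≤d ¬zp) ⟩
          1 + d z p      ≡⟨ cong (_+ d z p) (adj⇒d≡1 qz) ⟨
          d q z + d z p  ≡⟨ qp≡ ⟨
          d q p          ≡⟨ adj⇒d≡1 qp ⟩
          1              ∎) λ { (s≤s ()) }
        ...     | inj₂ up≡ = begin-strict
          d c' p         ≤⟨ adj-triangleʳ c' (adj-sym G qp) ⟩
          suc (d c' q)   ≤⟨ behind ⟩
          d u q          ≡⟨ uq≡ ⟩
          1 + d u z      <⟨ n<1+n (1 + d u z) ⟩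
          2 + d u z      ≡⟨ +-comm 2 (d u z) ⟩
          d u z + 2      ≤⟨ +-monoʳ-≤ (d u z) (¬closed⇒2≤d ¬zp) ⟩
          d u z + d z p  ≡⟨ up≡ ⟨
          d u p          ∎

    module _ (enumR : Enumeration R) where
      open Enumeration enumR

      T : Graph (suc size)
      T = record
        { Adj    = λ s t → Adj G (element s) (element t)
        ; adj?   = λ s t → adj? G (element s) (element t)
        ; sym    = adj-sym G
        ; irrefl = irrefl G
        }

      element≢ : ∀ {s t} → s ≢ t → element s ≢ element t
      element≢ s≢t eq = s≢t (trans (sym (index-element _)) (trans (cong index eq) (index-element _)))

      T-connected : Connected T
      T-connected s t _ _ = go (d (element s) (element t)) refl
        where
        go : ∀ k {s} → d (element s) (element t) ≡ k → WalkIn T ⊤ s t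
        go k {s} eq with s ≟ᶠ t
        ... | yes refl = here ∈⊤
        ... | no s≢t with toward (element-∈ s) (element-∈ t) (element≢ s≢t)
        go zero {s} eq | no s≢t | _ = contradiction (d≡0⇒≡ eq) (element≢ s≢t)
        go (suc k) {s} eq | no s≢t | r , r∈R , a , eq' = step ∈⊤
          (subst (Adj G (element s)) (sym (element-index r∈R)) a)
          (go k (trans (cong (λ z → d z (element t)) (element-index r∈R))
                       (suc-injective (trans (sym eq') eq))))

      behind-walk : ∀ {u c' S a b} → u ∈ R → c' ∈ R → Adj G u c' → (∀ {w} → w ∈ S → element w ≢ c') →
                    WalkIn T S a b → d c' (element a) < d u (element a) →
                    d c' (element b) < d u (element b)
      behind-walk u∈R c'∈R uc' avoid (here _) behind = behind
      behind-walk u∈R c'∈R uc' avoid (step {u = a} {w = b} a∈S ab p) behind =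
        behind-walk u∈R c'∈R uc' avoid p
          (behind-step u∈R c'∈R uc' (element-∈ a) (element-∈ b) (avoid a∈S) ab behind)

      -- For nonadjacent `s` and `t` let `c'` be selected for them. Seen from `s`, the vertex `t` is
      -- behind `c'` and `s` is not, so no walk from `t` to `s` avoids `c'`; yet `S` without `c'` is
      -- connected.
      noCutVertex⇒complete : ∀ S → NoCutVertexOn T S → ∀ s t → s ∈ S → t ∈ S → s ≢ t → Adj T s t
      noCutVertex⇒complete S (connS , connS-) s t s∈S t∈S s≢t = decidable-stable (adj? T s t) λ ¬st →
        let 2≤st = ¬closed⇒2≤d λ { (inj₁ eq) → element≢ s≢t eq ; (inj₂ a) → ¬st a }
            c' , c'∈R , (sc' , eq) , _ = sel (element s) (element t) (element-∈ s) 2≤st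
            c = index c'
            c≡ = element-index c'∈R
            s≢c : s ≢ c
            s≢c = λ s≡c → adj⇒≢ sc' (trans (cong element s≡c) c≡)
            t≢c : t ≢ c
            t≢c = λ t≡c → n≮n 1 (≤-trans 2≤st (≤-reflexive
                    (trans (cong (d (element s)) (trans (cong element t≡c) c≡)) (adj⇒d≡1 sc'))))
            absurd : ∀ {S'} → (∀ {w} → w ∈ S' → w ≢ c) → WalkIn T S' t s → _
            absurd = λ avoid p → n≮0 (subst (d c' (element s) <_) (d-refl (element s))
              (behind-walk (element-∈ s) c'∈R sc'
                (λ {w} w∈S' w≡ → avoid w∈S' (trans (sym (index-element w)) (cong index w≡)))
                p (≤-reflexive (sym eq))))
        in separated c s≢c t≢c absurd
        where
        separated : ∀ c → s ≢ c → t ≢ c → (∀ {S'} → (∀ {w} → w ∈ S' → w ≢ c) → ¬ WalkIn T S' t s) → ⊥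
        separated c s≢c t≢c absurd with c ∈? S
        ... | yes c∈S = absurd x∈p-y⇒x≢y
          (connS- c c∈S t s (x∈p∧x≢y⇒x∈p-y t∈S t≢c) (x∈p∧x≢y⇒x∈p-y s∈S s≢c))
        ... | no  c∉S = absurd (λ { w∈S refl → c∉S w∈S }) (connS t s t∈S s∈S)

      -- `index` is injective on `R`, so `T` is a copy of G[R] and every replacing clique is a
      -- single vertex.
      extended : ExtendedBlockGraphOn G R
      extended = size , T , index
        , (T-connected , λ S bl → noCutVertex⇒complete S (proj₁ bl))
        , (λ t → element t , element-∈ t , index-element t)
        , (λ u v u∈R v∈R u≢v → mk⇔
            (λ a → inj₂ (subst₂ (Adj G) (sym (element-index u∈R)) (sym (element-index v∈R)) a))
            (λ { (inj₁ eq) → contradiction (index-injective u∈R v∈R eq) u≢v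
               ; (inj₂ a)  → subst₂ (Adj G) (element-index u∈R) (element-index v∈R) a }))
        , λ u v u∈R v∈R eq _ → index-injective u∈R v∈R eq
        where
        index-injective : ∀ {u v} → u ∈ R → v ∈ R → index u ≡ index v → u ≡ v
        index-injective u∈R v∈R eq =
          trans (sym (element-index u∈R)) (trans (cong element eq) (element-index v∈R))

P3⇒Vertebrate : ∀ {n} (G : Graph (suc n)) → Connected G → P3 G → Vertebrate G
P3⇒Vertebrate G conn (R , covers , sel) =
  -- Covering any one vertex shows that `R` is nonempty.
  let r , r∈R , _ = covers zero
      B , _ , ne , selB , thinB = thin separating-mono R (r , r∈R) sel
  in B , ThinBlockGraph.extended thinB selB (enumerate B ne) , selects-dominating selB
  where open Metric G conn

-- From vertebrate to (P3): separation in a thinned backbone.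

module ThinBackbone {n m} (G : Graph n) (conn : Connected G) (T : Graph (suc m))
  (φ : Fin n → Fin (suc m)) (block : BlockGraph T) {B R : Subset n} (R⊆B : R ⊆ B)
  (adj⇔ : ∀ u v → u ∈ B → v ∈ B → u ≢ v → Adj G u v ⇔ (φ u ≡ φ v ⊎ Adj T (φ u) (φ v)))
  (thinR : Metric.Thin G conn R)
  (sel : Metric.Selects G conn (Metric.Dominating G conn) R)
  where

  open Metric G conn
  open Selected sel

  adj⇒image : ∀ {u v} → u ∈ R → v ∈ R → Adj G u v → φ u ≡ φ v ⊎ Adj T (φ u) (φ v)
  adj⇒image u∈R v∈R a = Equivalence.to (adj⇔ _ _ (R⊆B u∈R) (R⊆B v∈R) (adj⇒≢ a)) a

  image⇒adj : ∀ {u v} → u ∈ R → v ∈ R → u ≢ v → φ u ≡ φ v ⊎ Adj T (φ u) (φ v) → Adj G u v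
  image⇒adj u∈R v∈R u≢v = Equivalence.from (adj⇔ _ _ (R⊆B u∈R) (R⊆B v∈R) u≢v)

  twin-adj : ∀ {u v z} → u ∈ R → v ∈ R → z ∈ R → φ u ≡ φ v → v ≢ z → Adj G u z → Adj G v z
  twin-adj {z = z} u∈R v∈R z∈R eq v≢z a = image⇒adj v∈R z∈R v≢z
    (subst (λ t → t ≡ φ z ⊎ Adj T t (φ z)) eq (adj⇒image u∈R z∈R a))

  -- The next vertex of `R` from `u` towards `r` is `v` itself or, by `twin-adj`, a neighbour of
  -- `v`.
  twin-d : ∀ {u v r} → u ∈ R → v ∈ R → r ∈ R → φ u ≡ φ v → u ≢ r → d v r ≤ d u r
  twin-d {u} {v} {r} u∈R v∈R r∈R eq u≢r with toward u∈R r∈R u≢r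
  ... | h , h∈R , (uh , uh≡) with v ≟ᶠ h
  ...   | yes refl = subst (d v r ≤_) (sym uh≡) (n≤1+n _)
  ...   | no v≢h   = subst (d v r ≤_) (sym uh≡) (adj-triangle r (twin-adj u∈R v∈R h∈R eq v≢h uh))

  module Edge {c c'} (c∈R : c ∈ R) (c'∈R : c' ∈ R) (cc' : Adj G c c') where

    Behind Ahead : Fin n → Set
    Behind y = d c' y < d c y
    Ahead  y = d c y ≤ d c' y

    behind? : ∀ y → Dec (Behind y)
    behind? y = d c' y <? d c y

    ahead⇒≢c' : ∀ {w} → Ahead w → w ≢ c'
    ahead⇒≢c' ah refl = n≮0 (subst₂ _≤_ (adj⇒d≡1 cc') (d-refl c') ah)

    behind⇒2≤d : ∀ {r} → r ≢ c' → Behind r → 2 ≤ d c r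
    behind⇒2≤d r≢c' = ≤-trans (s≤s (≢⇒d>0 (r≢c' ∘ sym)))

    -- A twin of `c'` would be as near to `r` as `c'`. This is absurd for `c`, and any other twin
    -- would be a second element of N_R(c,r). Hence walks avoiding `c'` have images avoiding `φ c'`.
    image-injective-at-c' : ∀ {r w} → r ∈ R → r ≢ c' → Behind r → w ∈ R → w ≢ c' → φ w ≢ φ c'
    image-injective-at-c' {r} {w} r∈R r≢c' beh w∈R w≢c' eq with w ≟ᶠ c
    ... | yes refl = <⇒≱ beh (twin-d c'∈R c∈R r∈R (sym eq) (r≢c' ∘ sym))
    ... | no w≢c   = w≢c' (ncx-unique thinR sel c∈R (behind⇒2≤d r≢c' beh)
      w∈R (ncx (adj-sym G wc) (≤-<-trans (twin-d c'∈R w∈R r∈R (sym eq) (r≢c' ∘ sym)) beh))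
      c'∈R (ncx cc' beh))
      where
      wc : Adj G w c
      wc = twin-adj c'∈R w∈R c∈R (sym eq) w≢c (adj-sym G cc')

    image-walk : ∀ {r u v} → r ∈ R → r ≢ c' → Behind r →
                 WalkIn G (R - c') u v → WalkIn T (⊤ - φ c') (φ u) (φ v)
    image-walk r∈R r≢c' beh = go
      where
      φ-avoids : ∀ {w} → w ∈ R - c' → φ w ∈ ⊤ - φ c'
      φ-avoids w∈ = x∈p∧x≢y⇒x∈p-y ∈⊤
        (image-injective-at-c' r∈R r≢c' beh (x∈p-y⇒x∈p c' w∈) (x∈p-y⇒x≢y w∈))

      go : ∀ {u v} → WalkIn G (R - c') u v → WalkIn T (⊤ - φ c') (φ u) (φ v)
      go (here u∈) = here (φ-avoids u∈)
      go {v = v} (step u∈ a p) with adj⇒image (x∈p-y⇒x∈p c' u∈) (x∈p-y⇒x∈p c' (walk-start G p)) a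
      ... | inj₁ eq = subst (λ t → WalkIn T (⊤ - φ c') t (φ v)) (sym eq) (go p)
      ... | inj₂ b  = step (φ-avoids u∈) b (go p)

    -- Each step towards `c` lowers the distance to `c` by one and that to `c'` by at most one, so
    -- the walk stays ahead and never meets `c'`.
    ahead-walk : ∀ {w} → w ∈ R → Ahead w → WalkIn G (R - c') w c
    ahead-walk w∈R ah = go _ w∈R ah refl
      where
      go : ∀ k {w} → w ∈ R → Ahead w → d w c ≡ k → WalkIn G (R - c') w c
      go k {w} w∈R ah eq with w ≟ᶠ c
      ... | yes refl = here (x∈p∧x≢y⇒x∈p-y w∈R (ahead⇒≢c' ah))
      ... | no w≢c with toward w∈R c∈R w≢c
      go zero    w∈R ah eq | no w≢c | _ = contradiction (d≡0⇒≡ eq) w≢c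
      go (suc k) {w} w∈R ah eq | no w≢c | w' , w'∈R , (ww' , eq') =
        step (x∈p∧x≢y⇒x∈p-y w∈R (ahead⇒≢c' ah)) ww'
          (go k w'∈R (s≤s⁻¹ (begin
            suc (d c w')   ≡⟨ cong suc (d-sym c w') ⟩
            suc (d w' c)   ≡⟨ eq' ⟨
            d w c          ≡⟨ d-sym w c ⟩
            d c w          ≤⟨ ah ⟩
            d c' w         ≤⟨ adj-triangleʳ c' ww' ⟩
            suc (d c' w')  ∎)) (suc-injective (trans (sym eq') eq)))
        where open ≤-Reasoning

    -- The mirror image of `ahead-walk`, heading for `c'` and stopping one step before it.
    behind-walk : ∀ {w} → w ∈ R → w ≢ c' → Behind w →
                  ∃[ h ] (h ∈ R × Adj G c' h × Behind h × WalkIn G (R - c') w h)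
    behind-walk w∈R w≢c' beh = go _ w∈R w≢c' beh refl
      where
      go : ∀ k {w} → w ∈ R → w ≢ c' → Behind w → d w c' ≡ k →
           ∃[ h ] (h ∈ R × Adj G c' h × Behind h × WalkIn G (R - c') w h)
      go k {w} w∈R w≢c' beh eq with adj? G c' w
      ... | yes c'w = w , w∈R , c'w , beh , here (x∈p∧x≢y⇒x∈p-y w∈R w≢c')
      ... | no ¬c'w with toward w∈R c'∈R w≢c'
      go zero    w∈R w≢c' beh eq | no ¬c'w | _ = contradiction (d≡0⇒≡ eq) w≢c'
      go (suc k) {w} w∈R w≢c' beh eq | no ¬c'w | w' , w'∈R , (ww' , eq')
        with go k w'∈R (λ { refl → ¬c'w (adj-sym G ww') }) (s<s⁻¹ (begin-strict
            suc (d c' w')  ≡⟨ cong suc (d-sym c' w') ⟩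
            suc (d w' c')  ≡⟨ eq' ⟨
            d w c'         ≡⟨ d-sym w c' ⟩
            d c' w         <⟨ beh ⟩
            d c w          ≤⟨ adj-triangleʳ c ww' ⟩
            suc (d c w')   ∎)) (suc-injective (trans (sym eq') eq))
        where open ≤-Reasoning
      ... | h , h∈R , c'h , behh , p = h , h∈R , c'h , behh , step (x∈p∧x≢y⇒x∈p-y w∈R w≢c') ww' p

    -- An edge rs would close a cycle h … r s … c c' in B whose image in T avoids φ c' except at
    -- its ends, so the neighbours h and c of c' would be adjacent.
    no-crossing : ∀ {r s} → r ∈ R → s ∈ R → r ≢ c' → Behind r → Ahead s → ¬ Adj G r s
    no-crossing {r} {s} r∈R s∈R r≢c' beh ah rs with behind-walk r∈R r≢c' beh
    ... | h , h∈R , c'h , behh , p = n≮n 1 (≤-trans 2≤ch (≤-reflexive (adj⇒d≡1 (adj-sym G hc))))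
      where
      2≤ch : 2 ≤ d c h
      2≤ch = behind⇒2≤d (adj⇒≢ c'h ∘ sym) behh

      image-adj : ∀ {w} → w ∈ R → Adj G c' w → Adj T (φ c') (φ w)
      image-adj w∈R c'w with adj⇒image c'∈R w∈R c'w
      ... | inj₁ eq = contradiction (sym eq)
        (image-injective-at-c' r∈R r≢c' beh w∈R (adj⇒≢ c'w ∘ sym))
      ... | inj₂ a  = a

      hc : Adj G h c
      hc = image⇒adj h∈R c∈R (d>0⇒≢ (<-trans z<s 2≤ch) ∘ sym)
        (block-neighbours T block (image-adj h∈R c'h) (image-adj c∈R (adj-sym G cc'))
          (image-walk r∈R r≢c' beh
            (walk-trans G (walk-reverse G p)
              (step (x∈p∧x≢y⇒x∈p-y r∈R r≢c') rs (ahead-walk s∈R ah)))))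

    ahead-step : ∀ {s b} → s ∈ R → b ∈ R → b ≢ c' → Adj G s b → Ahead s → Ahead b
    ahead-step s∈R b∈R b≢c' sb ah =
      ≮⇒≥ λ beh → no-crossing b∈R s∈R b≢c' beh ah (adj-sym G sb)

    -- Passing from vertices of the whole graph to neighbours in `R`.

    ahead-neighbour : ∀ {p} → Ahead p → ∃[ s ] (s ∈ R × Ahead s × d s p ≤ 1)
    ahead-neighbour {p} ah with descend p c∈R
    ... | s , s∈R , ≤1 , eq = s , s∈R , +-cancelʳ-≤ (d s p) (d c s) (d c' s) (begin
      d c s + d s p   ≡⟨ eq ⟨
      d c p           ≤⟨ ah ⟩
      d c' p          ≤⟨ triangle c' s p ⟩
      d c' s + d s p  ∎) , ≤1
      where open ≤-Reasoning

    behind-neighbour : ∀ {q} → Behind q → ∃[ r ] (r ∈ R × Behind r × d r q ≤ 1)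
    behind-neighbour {q} beh with descend q c'∈R
    ... | r , r∈R , ≤1 , eq = r , r∈R , +-cancelʳ-< (d r q) (d c' r) (d c r) (begin-strict
      d c' r + d r q  ≡⟨ eq ⟨
      d c' q          <⟨ beh ⟩
      d c q           ≤⟨ triangle c r q ⟩
      d c r + d r q   ∎) , ≤1
      where open ≤-Reasoning

    -- By `no-crossing`, `s` and `r` are at distance two with `q` between them, so the vertex
    -- selected for them dominates `q`. Unless it is `c'`, it is ahead and adjacent to `r`, a
    -- forbidden crossing.
    mixed-neighbours : ∀ {q r s} → r ∈ R → s ∈ R → d r q ≤ 1 → d s q ≤ 1 →
                       r ≢ c' → Behind r → Ahead s → d c' q ≤ 1
    mixed-neighbours {q} {r} {s} r∈R s∈R rq sq r≢c' beh ah = conclude (sel s r s∈R 2≤sr)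
      where
      open ≤-Reasoning
      sr≤ : d s r ≤ 1 + d s q
      sr≤ = begin
        d s r          ≤⟨ triangle s q r ⟩
        d s q + d q r  ≤⟨ +-monoʳ-≤ (d s q) (subst (_≤ 1) (d-sym r q) rq) ⟩
        d s q + 1      ≡⟨ +-comm (d s q) 1 ⟩
        1 + d s q      ∎

      ¬closed : ¬ InClosedNbhd G s r
      ¬closed (inj₁ refl) = <⇒≱ beh ah
      ¬closed (inj₂ a)    = no-crossing r∈R s∈R r≢c' beh ah (adj-sym G a)

      2≤sr : 2 ≤ d s r
      2≤sr = ¬closed⇒2≤d ¬closed

      q∈N : InNcx G s r q
      q∈N = ncx (d≡1⇒adj (≤-antisym sq (s≤s⁻¹ (≤-trans 2≤sr sr≤))))
        (≤-<-trans (subst (_≤ 1) (d-sym r q) rq) 2≤sr)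

      conclude : ∃[ b ] (b ∈ R × InNcx G s r b × Dominating s r b) → d c' q ≤ 1
      conclude (b , b∈R , (sb , eq) , dom) with b ≟ᶠ c'
      ... | yes refl = closed⇒d≤1 (dom q q∈N q (inj₁ refl))
      ... | no b≢c' with d≤1⇒closed (s≤s⁻¹ (≤-trans (≤-reflexive (sym eq)) (≤-trans sr≤ (s≤s sq))))
      ...   | inj₁ refl = contradiction (inj₂ sb) ¬closed
      ...   | inj₂ br   = contradiction (adj-sym G br)
        (no-crossing r∈R b∈R r≢c' beh (ahead-step s∈R b∈R b≢c' sb ah))

    -- Here `p` lies in N(s,q), so the vertex selected for `s` and `q` dominates `p` and can stand
    -- in for it.
    bridge : ∀ {p q s} → s ∈ R → d s p ≤ 1 → Adj G p q → 2 ≤ d s q →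
             ∃[ b ] (b ∈ R × Adj G s b × d b q ≤ 1 × Dominates b p)
    bridge {p} {q} {s} s∈R sp pq 2≤sq with d≤1⇒closed sp
    ... | inj₁ refl = contradiction (≤-trans 2≤sq (≤-reflexive (adj⇒d≡1 pq))) (n≮n 1)
    ... | inj₂ a with sel s q s∈R 2≤sq
    ...   | b , b∈R , (sb , eq) , dom =
      b , b∈R , sb , s≤s⁻¹ (≤-trans (≤-reflexive (sym eq)) (≤-trans (adj-triangle q a)
            (s≤s (≤-reflexive (adj⇒d≡1 pq)))))
        , dom p (ncx a (≤-trans (s≤s (≤-reflexive (adj⇒d≡1 pq))) 2≤sq))

    -- Were `p` ahead, then its neighbour `s` in `R` or the bridge from `s` to `q` would be near
    -- `q`. If that vertex is `c'`, then `q` is not far; otherwise it is ahead, and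
    -- `mixed-neighbours` puts `q` near `c'`.
    behind-far : ∀ {p q} → Behind q → 2 ≤ d c' q → Adj G p q → Behind p
    behind-far {p} {q} behq far pq = decidable-stable (behind? p) λ ¬beh → refute (≮⇒≥ ¬beh)
      where
      refute : ¬ Ahead p
      refute ah with behind-neighbour behq | ahead-neighbour ah
      ... | r , r∈R , behr , rq | s , s∈R , ahs , sp = conclude
        where
        ¬ahead-near : ∀ {b} → b ∈ R → Ahead b → ¬ d b q ≤ 1
        ¬ahead-near b∈R ahb bq = <⇒≱ far
          (mixed-neighbours r∈R b∈R rq bq (λ { refl → <⇒≱ far rq }) behr ahb)

        conclude : ⊥
        conclude with d s q ≤? 1
        ... | yes sq = ¬ahead-near s∈R ahs sq
        ... | no ¬sq with bridge s∈R sp pq (≰⇒> ¬sq)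
        ...   | b , b∈R , sb , bq , _ with b ≟ᶠ c'
        ...     | yes refl = <⇒≱ far bq
        ...     | no b≢c'  = ¬ahead-near b∈R (ahead-step s∈R b∈R b≢c' sb ahs) bq

    module _ {q} (behq : Behind q) (c'q : Adj G c' q) where

      2≤cq : 2 ≤ d c q
      2≤cq = behind⇒2≤d (adj⇒≢ c'q ∘ sym) behq

      -- Being ahead, `b` is also near `c`; it is not `c`, so it lies in N_R(c,q) and equals `c'`.
      ¬ahead-near-both : ∀ {b} → b ∈ R → Ahead b → d c' b ≤ 1 → ¬ d b q ≤ 1
      ¬ahead-near-both b∈R ah c'b bq with d≤1⇒closed (≤-trans ah c'b)
      ... | inj₁ refl = <⇒≱ 2≤cq bq
      ... | inj₂ cb = ahead⇒≢c' ah (ncx-unique thinR sel c∈R 2≤cq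
        b∈R (ncx cb (≤-<-trans bq 2≤cq)) c'∈R (ncx cc' behq))

      -- If `b` is not near `c'`, the vertex selected for `c'` and `b` dominates `q`, is adjacent to
      -- `b` and hence ahead, and falls under `¬ahead-near-both`.
      ¬ahead-near : ∀ {b} → b ∈ R → Ahead b → ¬ d b q ≤ 1
      ¬ahead-near {b} b∈R ah bq with d c' b ≤? 1
      ... | yes c'b = ¬ahead-near-both b∈R ah c'b bq
      ... | no ¬c'b with sel c' b c'∈R (≰⇒> ¬c'b)
      ...   | e , e∈R , (c'e , eq) , dom =
        ¬ahead-near-both e∈R (ahead-step b∈R e∈R (adj⇒≢ c'e ∘ sym) be ah)
          (≤-reflexive (adj⇒d≡1 c'e)) (closed⇒d≤1 (dom q q∈N q (inj₁ refl)))
        where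
        qb≤1 : d q b ≤ 1
        qb≤1 = subst (_≤ 1) (d-sym b q) bq

        q∈N : InNcx G c' b q
        q∈N = ncx c'q (≤-<-trans qb≤1 (≰⇒> ¬c'b))

        be : Adj G b e
        be with d≤1⇒closed (s≤s⁻¹ (≤-trans (≤-reflexive (sym eq))
                  (≤-trans (adj-triangle b c'q) (s≤s qb≤1))))
        ... | inj₁ refl = contradiction (≤-reflexive (adj⇒d≡1 c'e)) ¬c'b
        ... | inj₂ a    = adj-sym G a

      -- The bridge to `q` dominates `p` and is near `q`; it must be `c'`, since otherwise it would
      -- be ahead.
      exit-dominated : ∀ {p} → Adj G p q → Ahead p → Dominates c' p
      exit-dominated pq ah with ahead-neighbour ah
      ... | s , s∈R , ahs , sp with d s q ≤? 1
      ...   | yes sq = contradiction sq (¬ahead-near s∈R ahs)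
      ...   | no ¬sq with bridge s∈R sp pq (≰⇒> ¬sq)
      ...     | b , b∈R , sb , bq , dom with b ≟ᶠ c'
      ...       | yes refl = dom
      ...       | no b≢c'  = contradiction bq (¬ahead-near b∈R (ahead-step s∈R b∈R b≢c' sb ahs))

    -- Follow the walk to its first step out of the vertices behind `c'`. That step starts in N[c']
    -- by `behind-far`; if not at `c'`, it ends at a vertex `w` dominated by `c'`, and `c'` can
    -- replace `w` in the walk.
    crossing-length : ∀ k {x y} → Behind x → Ahead y → 2 ≤ d c' y → WalkLen G k x y →
                      d x c' + d c' y ≤ k
    crossing-length zero beh ah far refl = contradiction ah (<⇒≱ beh)
    crossing-length (suc k) {x} {y} beh ah far (w , xw , p) with behind? w
    ... | yes behw = ≤-trans (+-monoˡ-≤ (d c' y) (adj-triangle c' xw))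
                             (s≤s (crossing-length k behw ah far p))
    ... | no ¬behw with d c' x ≤? 1
    ...   | no far-x = contradiction (behind-far beh (≰⇒> far-x) (adj-sym G xw)) ¬behw
    ...   | yes near with d≤1⇒closed near
    ...     | inj₁ refl = subst (λ i → i + d c' y ≤ suc k) (sym (d-refl c')) (d-least (w , xw , p))
    ...     | inj₂ c'x = through k p
      where
      open ≤-Reasoning
      dom : Dominates c' w
      dom = exit-dominated beh c'x (adj-sym G xw) (≮⇒≥ ¬behw)

      through : ∀ k → WalkLen G k w y → d x c' + d c' y ≤ suc k
      -- Ending at `w` would make `y` dominated by `c'`, hence near it; so a further vertex `w'`
      -- exists.
      through zero    refl = contradiction (closed⇒d≤1 (dom y (inj₁ refl))) (<⇒≱ far)
      through (suc k) (w' , ww' , p') = begin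
        d x c' + d c' y               ≡⟨ cong (_+ d c' y) (adj⇒d≡1 (adj-sym G c'x)) ⟩
        suc (d c' y)                  ≤⟨ s≤s (triangle c' w' y) ⟩
        suc (d c' w' + d w' y)        ≤⟨ s≤s (+-mono-≤ (closed⇒d≤1 (dom w' (inj₂ ww'))) (d-least p')) ⟩
        suc (suc k)                   ∎

    separating : ∀ {x} → Behind x → Separating c x c'
    separating {x} beh y 2≤ with behind? y
    ... | yes behy = inj₁ (trans (≤-antisym (adj-triangle y cc') behy)
                                 (cong (_+ d c' y) (sym (adj⇒d≡1 cc'))))
    ... | no ¬behy = inj₂ (≤-antisym (triangle x c' y)
                       (crossing-length (d x y) beh (≮⇒≥ ¬behy) 2≤ (d-walk x y)))

  selects-separating : Selects Separating R
  selects-separating c x c∈R 2≤ with sel c x c∈R 2≤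
  ... | c' , c'∈R , N@(cc' , eq) , _ =
    c' , c'∈R , N , Edge.separating c∈R c'∈R cc' (≤-reflexive (sym eq))

Vertebrate⇒P3 : ∀ {n} (G : Graph (suc n)) → Connected G → Vertebrate G → P3 G
Vertebrate⇒P3 G conn (B , (_ , T , φ , block , onto , adj⇔ , _) , sel) =
  -- `T` has at least one vertex, whose preimage makes `B` nonempty.
  let b , b∈B , _ = onto zero
      R , R⊆B , (r₀ , r₀∈R) , selR , thinR = thin dominating-mono B (b , b∈B) sel
  in R
   , (λ v → let r , r∈R , rv , _ = Selected.descend selR v r₀∈R in r , r∈R , d≤1⇒closed rv)
   , ThinBackbone.selects-separating G conn T φ block R⊆B adj⇔ thinR selR
  where open Metric G conn

theorem7 : ∀ n (G : Graph (suc n)) → Connected G →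
    (P3 G → Vertebrate G) × (Vertebrate G → P3 G)
theorem7 n G conn = P3⇒Vertebrate G conn , Vertebrate⇒P3 G conn
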